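{- Let $C_n$ be the cycle of length $n$ ($n\ge 3$) and let $C'_n$ be the graph obtained from $C_n$ by removing an edge $uv$ (keeping all vertices). Then $meg(C'_n)=2$.
   Context: Graphs are finite, undirected and simple. In a connected graph $H$, an edge $e$ is monitored by a pair of vertices $x,y$ if $e$ lies on all shortest paths between $x$ and $y$. A set $M\subseteq V(H)$ is a monitoring edge-geodetic set (MEG-set) of $H$ if every edge of $H$ is monitored by some pair of vertices of $M$; $meg(H)$ is the minimum size of a MEG-set of $H$. -}

module Defs where

open import Data.Fin.Base using (Fin; toℕ; fromℕ<)
open import Data.Fin.Properties using (_≟_; toℕ-injective; toℕ<n; toℕ-fromℕ<)
open import Data.Fin.Subset using (Subset; _∈_; ∣_∣)
open import Data.List.Base using (List; []; _∷_)
import Data.List.Membership.Propositional as List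
open import Data.List.Relation.Unary.Unique.Propositional using (Unique)
open import Data.Nat.Base using (ℕ; zero; suc; _+_; _≤_; _<_; z≤n; s≤s; s≤s⁻¹)
import Data.Nat.Properties as ℕ
open import Data.Product.Base using (∃-syntax; _×_; _,_; proj₁)
open import Data.Sum.Base using (_⊎_; inj₁; inj₂; swap)
open import Function.Base using (_∘_)
open import Relation.Binary.Construct.Closure.ReflexiveTransitive
  using (Star; ε; _◅_; _◅◅_; reverse)
import Relation.Binary.Construct.Closure.ReflexiveTransitive as Star
open import Relation.Binary.Definitions using (Decidable; Symmetric)
open import Relation.Binary.PropositionalEquality
  using (_≡_; _≢_; refl; sym; trans; cong; subst)
open import Relation.Nullary using (¬_; yes; no)
open import Relation.Nullary.Decidable using (_×-dec_; _⊎-dec_; ¬?)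

record Graph (n : ℕ) : Set₁ where
  field
    Adj     : Fin n → Fin n → Set
    adj-sym : Symmetric Adj
    no-loop : ∀ {x} → ¬ Adj x x
    adj?    : Decidable Adj

module _ {n : ℕ} (G : Graph n) where
  open Graph G

  Walk : Fin n → Fin n → Set
  Walk = Star Adj

  Connected : Set
  Connected = ∀ x y → Walk x y

  length : ∀ {x y} → Walk x y → ℕ
  length ε       = 0
  length (_ ◅ w) = suc (length w)

  vertices : ∀ {x y} → Walk x y → List (Fin n)
  vertices {x} ε       = x ∷ []
  vertices {x} (_ ◅ w) = x ∷ vertices w

  -- The edges traversed, each oriented in the direction of travel.
  steps : ∀ {x y} → Walk x y → List (Fin n × Fin n)
  steps ε                 = []
  steps (_◅_ {x} {y} _ w) = (x , y) ∷ steps w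

  IsPath : ∀ {x y} → Walk x y → Set
  IsPath w = Unique (vertices w)

  IsShortestPath : ∀ {x y} → Walk x y → Set
  IsShortestPath {x} {y} p =
    IsPath p × (∀ (q : Walk x y) → IsPath q → length p ≤ length q)

  LiesOn : (a b : Fin n) → ∀ {x y} → Walk x y → Set
  LiesOn a b p = (a , b) List.∈ steps p ⊎ (b , a) List.∈ steps p

-- Connectedness matters here: without it, a pair of vertices in different
-- components would vacuously monitor every edge.
record ConnectedGraph (n : ℕ) : Set₁ where
  field
    graph     : Graph n
    connected : Connected graph
  open Graph graph public

module _ {n : ℕ} (H : ConnectedGraph n) where
  open ConnectedGraph H

  Monitors : (x y a b : Fin n) → Set
  Monitors x y a b =
    ∀ (p : Walk graph x y) → IsShortestPath graph p → LiesOn graph a b p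

  -- The two monitoring vertices need not be required to be distinct: the only
  -- shortest path from x to x has no edges, so the pair x, x monitors nothing.
  IsMEGSet : Subset n → Set
  IsMEGSet M = ∀ a b → Adj a b →
    ∃[ x ] ∃[ y ] x ∈ M × y ∈ M × Monitors x y a b

  Meg≡ : ℕ → Set
  Meg≡ k = (∃[ M ] IsMEGSet M × ∣ M ∣ ≡ k)
         × (∀ M → IsMEGSet M → k ≤ ∣ M ∣)

module _ {n : ℕ} where

  SameEdge : (x y u v : Fin n) → Set
  SameEdge x y u v = (x ≡ u × y ≡ v) ⊎ (x ≡ v × y ≡ u)

  deleteEdge : Graph n → Fin n → Fin n → Graph n
  deleteEdge G u v = record
    { Adj     = λ x y → Adj x y × ¬ SameEdge x y u v
    ; adj-sym = λ (xy , xy≠uv) → adj-sym xy , xy≠uv ∘ λ where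
        (inj₁ (y≡u , x≡v)) → inj₂ (x≡v , y≡u)
        (inj₂ (y≡v , x≡u)) → inj₁ (x≡u , y≡v)
    ; no-loop = no-loop ∘ proj₁
    ; adj?    = λ x y → adj? x y ×-dec
        ¬? ((x ≟ u ×-dec y ≟ v) ⊎-dec (x ≟ v ×-dec y ≟ u))
    }
    where open Graph G

-- j = i + 1 modulo n
Next : ∀ {n} → Fin n → Fin n → Set
Next {n} i j = suc (toℕ i) ≡ toℕ j ⊎ (suc (toℕ i) ≡ n × toℕ j ≡ 0)

cycle : ∀ n → 3 ≤ n → Graph n
cycle n n≥3 = record
  { Adj     = λ i j → Next i j ⊎ Next j i
  ; adj-sym = swap
  ; no-loop = λ { (inj₁ p) → irrefl p ; (inj₂ p) → irrefl p }
  ; adj?    = λ i j → next? i j ⊎-dec next? j i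
  }
  where
  irrefl : ∀ {i : Fin n} → ¬ Next i i
  irrefl (inj₁ 1+i≡i) = ℕ.1+n≢n 1+i≡i
  irrefl (inj₂ (1+i≡n , i≡0)) =
    ℕ.<⇒≢ (ℕ.<-≤-trans (s≤s (s≤s z≤n)) n≥3) (trans (cong suc (sym i≡0)) 1+i≡n)

  next? : Decidable (Next {n})
  next? i j = (suc (toℕ i) ℕ.≟ toℕ j)
       ⊎-dec ((suc (toℕ i) ℕ.≟ n) ×-dec (toℕ j ℕ.≟ 0))

Next-asym : ∀ {n} → 3 ≤ n → {i j : Fin n} → Next i j → ¬ Next j i
Next-asym n≥3 (inj₁ p) (inj₁ q) =
  ℕ.<-asym (ℕ.≤-reflexive p) (ℕ.≤-reflexive q)
Next-asym n≥3 (inj₁ p) (inj₂ (q , r)) =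
  ℕ.<⇒≢ n≥3 (trans (cong (suc ∘ suc) (sym r)) (trans (cong suc p) q))
Next-asym n≥3 (inj₂ (q , r)) (inj₁ p) =
  ℕ.<⇒≢ n≥3 (trans (cong (suc ∘ suc) (sym r)) (trans (cong suc p) q))
Next-asym n≥3 (inj₂ (p , r)) (inj₂ (q , s)) =
  ℕ.<⇒≢ (ℕ.<-≤-trans (s≤s (s≤s z≤n)) n≥3) (trans (cong suc (sym s)) p)

-- When v is the successor of u, the vertices up to u are reached from 0 by
-- going up, and those beyond u by going down from n - 1, which is adjacent
-- to 0.
cycle-delete-next-connected :
  ∀ n (n≥3 : 3 ≤ n) {u v : Fin n} → Next u v →
  Connected (deleteEdge (cycle n n≥3) u v)
cycle-delete-next-connected (suc m) n≥3 {u} {v} u→v x y =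
  reverse adj-sym (from0 x) ◅◅ from0 y
  where
  D = deleteEdge (cycle (suc m) n≥3) u v
  open Graph D using (Adj; adj-sym)

  survives : ∀ {i j} → Next i j → i ≢ u → Adj i j
  survives i→j i≢u = inj₁ i→j , λ where
    (inj₁ (i≡u , _))    → i≢u i≡u
    (inj₂ (refl , refl)) → Next-asym n≥3 u→v i→j

  o : Fin (suc m)
  o = Fin.zero

  up : ∀ k (x : Fin (suc m)) → toℕ x ≡ k → k ≤ toℕ u → Walk D o x
  up zero    x x≡0   _   = subst (Walk D o) (toℕ-injective (sym x≡0)) ε
  up (suc k) x x≡1+k k<u =
    up k w w≡k (ℕ.<⇒≤ k<u) ◅◅ (survives (inj₁ w→x) w≢u ◅ ε)
    where
    k<n : k < suc m
    k<n = ℕ.<-trans k<u (toℕ<n u)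
    w = fromℕ< k<n
    w≡k : toℕ w ≡ k
    w≡k = toℕ-fromℕ< k<n
    w→x : suc (toℕ w) ≡ toℕ x
    w→x = trans (cong suc w≡k) (sym x≡1+k)
    w≢u : w ≢ u
    w≢u w≡u = ℕ.<⇒≢ k<u (trans (sym w≡k) (cong toℕ w≡u))

  down : ∀ d (x : Fin (suc m)) → toℕ x + d ≡ m → toℕ u < toℕ x → Walk D x o
  down zero x x+0≡m u<x =
    survives (inj₂ (cong suc (trans (sym (ℕ.+-identityʳ _)) x+0≡m) , refl))
             (λ x≡u → ℕ.<⇒≢ u<x (cong toℕ (sym x≡u))) ◅ ε
  down (suc d) x x+1+d≡m u<x =
    survives (inj₁ (sym w≡1+x)) (λ x≡u → ℕ.<⇒≢ u<x (cong toℕ (sym x≡u)))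
      ◅ down d w (trans (cong (_+ d) w≡1+x) 1+x+d≡m)
               (subst (toℕ u <_) (sym w≡1+x) (ℕ.m<n⇒m<1+n u<x))
    where
    1+x+d≡m : suc (toℕ x) + d ≡ m
    1+x+d≡m = trans (sym (ℕ.+-suc (toℕ x) d)) x+1+d≡m
    1+x<n : suc (toℕ x) < suc m
    1+x<n = s≤s (subst (suc (toℕ x) ≤_) 1+x+d≡m (ℕ.m≤m+n _ d))
    w = fromℕ< 1+x<n
    w≡1+x : toℕ w ≡ suc (toℕ x)
    w≡1+x = toℕ-fromℕ< 1+x<n

  from0 : ∀ x → Walk D o x
  from0 x with toℕ x ℕ.≤? toℕ u
  ... | yes x≤u = up (toℕ x) x refl x≤u
  ... | no  x≰u = reverse adj-sym
    (down _ x (ℕ.m+[n∸m]≡n (s≤s⁻¹ (toℕ<n x))) (ℕ.≰⇒> x≰u))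

cycle-delete-connected :
  ∀ n (n≥3 : 3 ≤ n) {u v : Fin n} → Graph.Adj (cycle n n≥3) u v →
  Connected (deleteEdge (cycle n n≥3) u v)
cycle-delete-connected n n≥3 (inj₁ u→v)     = cycle-delete-next-connected n n≥3 u→v
cycle-delete-connected n n≥3 (inj₂ v→u) x y =
  Star.map (λ (xy , xy≠vu) → xy , xy≠vu ∘ swap)
           (cycle-delete-next-connected n n≥3 v→u x y)

cycleMinusEdge : ∀ n (n≥3 : 3 ≤ n) (u v : Fin n) →
                 Graph.Adj (cycle n n≥3) u v → ConnectedGraph n
cycleMinusEdge n n≥3 u v uv = record
  { graph     = deleteEdge (cycle n n≥3) u v
  ; connected = cycle-delete-connected n n≥3 uv
  }

{-# OPTIONS --safe #-}

-- The graph C'_n is a path with endpoints u and v. Number its vertices along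
-- the path by a rank: each edge joins consecutive ranks, so a walk from one
-- endpoint to the other, having to pass from rank k to rank k + 1, uses the
-- edge joining them. Hence the two endpoints monitor every edge. Conversely a
-- vertex paired with itself monitors nothing, so a graph with an edge has no
-- MEG-set of size less than 2.
module Submission where

open import Defs
open import Data.Nat.Base using (ℕ; suc; _+_; _≤_; _<_; z≤n; s≤s; s≤s⁻¹)
import Data.Nat.Properties as ℕ
open import Data.Fin.Base using (Fin; toℕ)
open import Data.Fin.Properties using (toℕ-injective; toℕ<n)
open import Data.Fin.Subset
  using (Subset; _∈_; ∣_∣; _∪_; ⁅_⁆; inside; outside)
open import Data.Fin.Subset.Properties
  using (x∈⁅x⁆; ∣⁅x⁆∣≡1; x∈p∪q⁺; x∈p∧x≢y⇒x∈p-y; x∈p⇒∣p-x∣<∣p∣)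
import Data.List.Membership.Propositional as List
open import Data.List.Relation.Unary.All using ([])
open import Data.List.Relation.Unary.Any using (here; there)
open import Data.List.Relation.Unary.AllPairs using ([]; _∷_)
open import Data.Product.Base using (∃-syntax; _×_; _,_)
open import Data.Sum.Base using (_⊎_; inj₁; inj₂; swap)
import Data.Sum.Base as Sum
open import Data.Vec.Base using ([]; _∷_)
open import Function.Base using (_∘_)
open import Function.Definitions using (Injective)
open import Relation.Binary.Construct.Closure.ReflexiveTransitive using (ε; _◅_)
open import Relation.Binary.PropositionalEquality
  using (_≡_; _≢_; refl; sym; trans; cong; subst; module ≡-Reasoning)
open import Relation.Nullary using (¬_; yes; no; contradiction)

∣p∪q∣≤∣p∣+∣q∣ : ∀ {n} (p q : Subset n) → ∣ p ∪ q ∣ ≤ ∣ p ∣ + ∣ q ∣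
∣p∪q∣≤∣p∣+∣q∣ []            []            = z≤n
∣p∪q∣≤∣p∣+∣q∣ (outside ∷ p) (outside ∷ q) = ∣p∪q∣≤∣p∣+∣q∣ p q
∣p∪q∣≤∣p∣+∣q∣ (outside ∷ p) (inside ∷ q)  =
  subst (suc ∣ p ∪ q ∣ ≤_) (sym (ℕ.+-suc ∣ p ∣ ∣ q ∣)) (s≤s (∣p∪q∣≤∣p∣+∣q∣ p q))
∣p∪q∣≤∣p∣+∣q∣ (inside ∷ p)  (outside ∷ q) = s≤s (∣p∪q∣≤∣p∣+∣q∣ p q)
∣p∪q∣≤∣p∣+∣q∣ (inside ∷ p)  (inside ∷ q)  =
  s≤s (ℕ.≤-trans (∣p∪q∣≤∣p∣+∣q∣ p q) (ℕ.+-monoʳ-≤ ∣ p ∣ (ℕ.n≤1+n ∣ q ∣)))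

x∈p⇒0<∣p∣ : ∀ {n} {x : Fin n} {p : Subset n} → x ∈ p → 0 < ∣ p ∣
x∈p⇒0<∣p∣ x∈p = ℕ.≤-<-trans z≤n (x∈p⇒∣p-x∣<∣p∣ x∈p)

-- Removing `y` makes `p` strictly smaller, and the remainder still contains `x`.
x≢y⇒2≤∣p∣ : ∀ {n} {x y : Fin n} {p : Subset n} →
            x ≢ y → x ∈ p → y ∈ p → 2 ≤ ∣ p ∣
x≢y⇒2≤∣p∣ x≢y x∈p y∈p =
  ℕ.≤-<-trans (x∈p⇒0<∣p∣ (x∈p∧x≢y⇒x∈p-y x∈p x≢y)) (x∈p⇒∣p-x∣<∣p∣ y∈p)

x≢y⇒∣⁅x⁆∪⁅y⁆∣≡2 : ∀ {n} {x y : Fin n} → x ≢ y → ∣ ⁅ x ⁆ ∪ ⁅ y ⁆ ∣ ≡ 2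
x≢y⇒∣⁅x⁆∪⁅y⁆∣≡2 {x = x} {y} x≢y = ℕ.≤-antisym ≤2
  (x≢y⇒2≤∣p∣ x≢y (x∈p∪q⁺ (inj₁ (x∈⁅x⁆ x))) (x∈p∪q⁺ (inj₂ (x∈⁅x⁆ y))))
  where
  ≤2 : ∣ ⁅ x ⁆ ∪ ⁅ y ⁆ ∣ ≤ 2
  ≤2 with ∣p∪q∣≤∣p∣+∣q∣ ⁅ x ⁆ ⁅ y ⁆
  ... | le rewrite ∣⁅x⁆∣≡1 x | ∣⁅x⁆∣≡1 y = le

module _ {n : ℕ} (H : ConnectedGraph n) where
  open ConnectedGraph H

  Monitors⇒≢ : ∀ {x y a b} → Monitors H x y a b → x ≢ y
  Monitors⇒≢ mon refl with mon ε (([] ∷ []) , λ _ _ → z≤n)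
  ... | inj₁ ()
  ... | inj₂ ()

  -- A walk between distinct `s` and `t` has a first step, and the pair monitoring that edge
  -- consists of two distinct vertices of `M`.
  IsMEGSet⇒2≤∣M∣ : ∀ {s t} → s ≢ t → ∀ M → IsMEGSet H M → 2 ≤ ∣ M ∣
  IsMEGSet⇒2≤∣M∣ {s} {t} s≢t M meg with connected s t
  ... | ε      = contradiction refl s≢t
  ... | sb ◅ _ =
    let x , y , x∈M , y∈M , mon = meg _ _ sb
    in x≢y⇒2≤∣p∣ (Monitors⇒≢ mon) x∈M y∈M

-- A discrete intermediate value argument: the first step along which `f` exceeds `k` is the
-- crossing.
walk-crosses : ∀ {n} (G : Graph n) (f : Fin n → ℕ) k {x y} (w : Walk G x y) →
  f x ≤ k → k < f y →
  ∃[ p ] ∃[ q ] (p , q) List.∈ steps G w × Graph.Adj G p q × f p ≤ k × k < f q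
walk-crosses G f k ε fx≤k k<fx = contradiction fx≤k (ℕ.<⇒≱ k<fx)
walk-crosses G f k (_◅_ {x} {z} xz w) fx≤k k<fy with f z ℕ.≤? k
... | no  fz≰k = x , z , here refl , xz , fx≤k , ℕ.≰⇒> fz≰k
... | yes fz≤k =
  let p , q , pq∈w , rest = walk-crosses G f k w fz≤k k<fy
  in p , q , there pq∈w , rest

module _ {n : ℕ} (H : ConnectedGraph n) (rank : Fin n → ℕ)
  (rank-injective : Injective _≡_ _≡_ rank)
  (rank-adj : ∀ {x y} → ConnectedGraph.Adj H x y →
              rank y ≡ suc (rank x) ⊎ rank x ≡ suc (rank y))
  {s t : Fin n} (rank-min : ∀ x → rank s ≤ rank x) (rank-max : ∀ x → rank x ≤ rank t)
  where
  open ConnectedGraph H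

  -- The walk must cross level `rank a`. Since ranks change by one per step, the crossing step runs
  -- from rank `rank a` to the next, and injectivity identifies it with `(a , b)`.
  walk-covers : ∀ {a b} → rank b ≡ suc (rank a) → (w : Walk graph s t) →
                (a , b) List.∈ steps graph w
  walk-covers {a} {b} b≡1+a w
    with p , q , pq∈w , pq , p≤a , a<q ← walk-crosses graph rank (rank a) w (rank-min a)
           (ℕ.≤-trans (ℕ.≤-reflexive (sym b≡1+a)) (rank-max b))
    with rank-adj pq
  ... | inj₂ p≡1+q =
    contradiction (ℕ.<-trans a<q (ℕ.≤-reflexive (sym p≡1+q))) (ℕ.≤⇒≯ p≤a)
  ... | inj₁ q≡1+p
    with refl ← rank-injective
           (ℕ.≤-antisym p≤a (s≤s⁻¹ (subst (rank a <_) q≡1+p a<q)))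
    with refl ← rank-injective (trans q≡1+p (sym b≡1+a)) = pq∈w

  endpoints-monitor : ∀ {a b} → Adj a b → Monitors H s t a b
  endpoints-monitor ab w _ =
    Sum.map (λ r → walk-covers r w) (λ r → walk-covers r w) (rank-adj ab)

  meg-path : s ≢ t → Meg≡ H 2
  meg-path s≢t =
    ( ⁅ s ⁆ ∪ ⁅ t ⁆
    , (λ a b ab → s , t , x∈p∪q⁺ (inj₁ (x∈⁅x⁆ s)) , x∈p∪q⁺ (inj₂ (x∈⁅x⁆ t))
                , endpoints-monitor ab)
    , x≢y⇒∣⁅x⁆∪⁅y⁆∣≡2 s≢t
    ) , IsMEGSet⇒2≤∣M∣ H s≢t

-- Cutting the cycle after u puts u + 1, …, n - 1, 0, …, u in path order.
rank : ∀ {n} → Fin n → Fin n → ℕ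
rank {n} u x with toℕ x ℕ.≤? toℕ u
... | yes _ = toℕ x + n
... | no  _ = toℕ x

module _ {n : ℕ} (u : Fin n) where

  rank-upto : ∀ {x} → toℕ x ≤ toℕ u → rank u x ≡ toℕ x + n
  rank-upto {x} x≤u with toℕ x ℕ.≤? toℕ u
  ... | yes _   = refl
  ... | no  x≰u = contradiction x≤u x≰u

  rank-beyond : ∀ {x} → toℕ u < toℕ x → rank u x ≡ toℕ x
  rank-beyond {x} u<x with toℕ x ℕ.≤? toℕ u
  ... | yes x≤u = contradiction x≤u (ℕ.<⇒≱ u<x)
  ... | no  _   = refl

  -- Shifted ranks are at least `n` and unshifted ones are below `n`, so the two kinds never
  -- collide.
  rank-injective : Injective _≡_ _≡_ (rank u)
  rank-injective {x} {y} eq with toℕ x ℕ.≤? toℕ u | toℕ y ℕ.≤? toℕ u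
  ... | yes _ | yes _ = toℕ-injective (ℕ.+-cancelʳ-≡ n _ _ eq)
  ... | yes _ | no  _ = contradiction (toℕ<n y) (ℕ.≤⇒≯ (subst (n ≤_) eq (ℕ.m≤n+m n _)))
  ... | no  _ | yes _ = contradiction (toℕ<n x) (ℕ.≤⇒≯ (subst (n ≤_) (sym eq) (ℕ.m≤n+m n _)))
  ... | no  _ | no  _ = toℕ-injective eq

  -- The only break in the numbering is right after `u`; the wrap-around from `n - 1` to `0` becomes
  -- a step from rank `n - 1` to rank `n`.
  rank-next : ∀ {x y} → Next x y → x ≢ u → rank u y ≡ suc (rank u x)
  rank-next {x} {y} (inj₁ 1+x≡y) x≢u with toℕ x ℕ.≤? toℕ u
  ... | yes x≤u = trans
    (rank-upto (subst (_≤ toℕ u) 1+x≡y (ℕ.≤∧≢⇒< x≤u (x≢u ∘ toℕ-injective))))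
    (cong (_+ n) (sym 1+x≡y))
  ... | no  x≰u = trans
    (rank-beyond (subst (toℕ u <_) 1+x≡y (ℕ.m<n⇒m<1+n (ℕ.≰⇒> x≰u))))
    (sym 1+x≡y)
  rank-next {x} {y} (inj₂ (1+x≡n , y≡0)) x≢u with toℕ x ℕ.≤? toℕ u
  -- Here `x` would lie strictly below `u`, so it could not be the last vertex `n - 1`.
  ... | yes x≤u = contradiction
    (ℕ.≤-<-trans (ℕ.≤∧≢⇒< x≤u (x≢u ∘ toℕ-injective)) (toℕ<n u)) (ℕ.<-irrefl 1+x≡n)
  ... | no  _   = begin
    rank u y    ≡⟨ rank-upto (subst (_≤ toℕ u) (sym y≡0) z≤n) ⟩
    toℕ y + n   ≡⟨ cong (_+ n) y≡0 ⟩
    n           ≡⟨ sym 1+x≡n ⟩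
    suc (toℕ x) ∎
    where open ≡-Reasoning

  -- Ranks fill the interval from `toℕ u + 1` to `toℕ u + n`; the successor of `u` attains the lower
  -- end and `u` the upper.
  rank-lower : ∀ x → suc (toℕ u) ≤ rank u x
  rank-lower x with toℕ x ℕ.≤? toℕ u
  ... | yes _   = ℕ.≤-trans (toℕ<n u) (ℕ.m≤n+m n _)
  ... | no  x≰u = ℕ.≰⇒> x≰u

  rank-successor : ∀ {v} → Next u v → rank u v ≡ suc (toℕ u)
  rank-successor (inj₁ 1+u≡v) =
    trans (rank-beyond (ℕ.≤-reflexive 1+u≡v)) (sym 1+u≡v)
  -- If `u` is the last vertex, every vertex is shifted, and `v`, being `0`, gets rank `n`.
  rank-successor (inj₂ (1+u≡n , v≡0)) =
    trans (rank-upto (subst (_≤ toℕ u) (sym v≡0) z≤n))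
          (trans (cong (_+ n) v≡0) (sym 1+u≡n))

  rank-max : ∀ x → rank u x ≤ rank u u
  rank-max x rewrite rank-upto {u} ℕ.≤-refl with toℕ x ℕ.≤? toℕ u
  ... | yes x≤u = ℕ.+-monoˡ-≤ n x≤u
  ... | no  _   = ℕ.≤-trans (ℕ.<⇒≤ (toℕ<n x)) (ℕ.m≤n+m n _)

-- The path runs from `v`, of least rank, to `u`, of greatest. Taking a general `H` with this
-- adjacency property lets both orientations of the removed edge be handled at once.
meg-cut-after : ∀ {n} (n≥3 : 3 ≤ n) {u v : Fin n} (H : ConnectedGraph n) →
  (∀ {x y} → ConnectedGraph.Adj H x y →
             Graph.Adj (cycle n n≥3) x y × ¬ SameEdge x y u v) →
  Next u v → Meg≡ H 2
meg-cut-after {n} n≥3 {u} {v} H H⊆ u→v =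
  meg-path H (rank u) (rank-injective u) (rank-adj ∘ H⊆)
    (λ x → subst (_≤ rank u x) (sym (rank-successor u u→v)) (rank-lower u x))
    (rank-max u)
    (λ v≡u → Graph.no-loop (cycle n n≥3) (inj₁ (subst (Next u) v≡u u→v)))
  where
  next-unique : ∀ {x} → Next u x → x ≡ v
  next-unique u→x = rank-injective u
    (trans (rank-successor u u→x) (sym (rank-successor u u→v)))

  rank-adj : ∀ {x y} → Graph.Adj (cycle n n≥3) x y × ¬ SameEdge x y u v →
             rank u y ≡ suc (rank u x) ⊎ rank u x ≡ suc (rank u y)
  rank-adj (inj₁ x→y , xy≠uv) =
    -- A cycle edge from `u` to its successor would be the removed edge, so `rank-next` applies to
    -- every edge left.
    inj₁ (rank-next u x→y λ { refl → xy≠uv (inj₁ (refl , next-unique x→y)) })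
  rank-adj (inj₂ y→x , xy≠uv) =
    inj₂ (rank-next u y→x λ { refl → xy≠uv (inj₂ (next-unique y→x , refl)) })

corollary3p3 : ∀ (n : ℕ) (n≥3 : 3 ≤ n) (u v : Fin n) →
    (uv : Graph.Adj (cycle n n≥3) u v) →
    Meg≡ (cycleMinusEdge n n≥3 u v uv) 2
corollary3p3 n n≥3 u v uv@(inj₁ u→v) =
  meg-cut-after n≥3 (cycleMinusEdge n n≥3 u v uv) (λ xy → xy) u→v
-- The cut now comes after `v`, so the ends of the removed edge trade roles.
corollary3p3 n n≥3 u v uv@(inj₂ v→u) =
  meg-cut-after n≥3 (cycleMinusEdge n n≥3 u v uv)
    (λ (xy , xy≠uv) → xy , xy≠uv ∘ swap) v→u
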